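{- There is an almost sure event $\mathcal A\subseteq 2^\omega$ such that if $X\in\mathcal A$ then $X$ has an infinite subset $Y\subseteq X$ such that no element of $\mathcal A$ is Turing reducible to $Y$.
   Context: $\omega=\{0,1,2,\ldots\}$. Sets $X\subseteq\omega$ are identified with their characteristic sequences in $2^\omega$. An event is a measurable subset of $2^\omega$ (the power set of $\omega$); it is almost sure if it has probability $1$ under the fair-coin (Lebesgue) measure on $2^\omega$. -}

module Defs where

open import Level using (0ℓ)
open import Data.Bool using (Bool; true; if_then_else_)
open import Data.Fin using (Fin)
open import Data.List using (List; []; _∷_; length; applyUpTo)
open import Data.Nat using (ℕ; zero; suc)
import Data.Nat as ℕ
open import Data.Product using (Σ-syntax; ∃-syntax; _×_)
open import Data.Rational using (ℚ; 0ℚ; 1ℚ; ½; _+_; _*_; _≤_; _<_)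
open import Data.Vec using (Vec; []; _∷_; lookup)
open import Function using (_⇔_)
open import Relation.Binary.Definitions using (_Respects_)
open import Relation.Binary.PropositionalEquality using (_≡_; _≗_)
open import Relation.Unary using (Pred; _∈_; _⊆_; _∩_; ∁; ⋃)

2^ω : Set
2^ω = ℕ → Bool

infix 4 _∈ω_ _⊆ω_ _≤T_

_∈ω_ : ℕ → 2^ω → Set
n ∈ω X = X n ≡ true

_⊆ω_ : 2^ω → 2^ω → Set
Y ⊆ω X = ∀ n → n ∈ω Y → n ∈ω X

Infinite : 2^ω → Set
Infinite X = ∀ n → ∃[ m ] n ℕ.≤ m × m ∈ω X

------------------------------------------------------------------------
-- Fair-coin measure

Cylinder : List Bool → Pred 2^ω 0ℓ
Cylinder σ X = applyUpTo X (length σ) ≡ σ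

cylinderMeasure : List Bool → ℚ
cylinderMeasure []      = 1ℚ
cylinderMeasure (_ ∷ σ) = ½ * cylinderMeasure σ

∑[i<_]_ : ℕ → (ℕ → ℚ) → ℚ
∑[i< zero  ] f = 0ℚ
∑[i< suc n ] f = (∑[i< n ] f) + f n

-- The sum of the (possibly irrational) series of measures is < r iff some
-- rational q < r bounds all its partial sums.
TotalMeasure_<_ : (ℕ → List Bool) → ℚ → Set
TotalMeasure C < r =
  ∃[ q ] q < r × (∀ n → ∑[i< n ] (λ i → cylinderMeasure (C i)) ≤ q)

-- Outer measure is the infimum of the total measures of countable cylinder
-- covers. Being a real number, it is given by the rationals r above it.
λ*_<_ : Pred 2^ω 0ℓ → ℚ → Set
λ* S < r = Σ[ C ∈ (ℕ → List Bool) ]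
  S ⊆ ⋃ ℕ (λ i → Cylinder (C i)) × TotalMeasure C < r

λ*_≐_ : Pred 2^ω 0ℓ → ℚ → Set
λ* S ≐ q = ∀ r → (λ* S < r) ⇔ q < r

-- Carathéodory's criterion  λ*(T ∩ S) + λ*(T ∖ S) ≤ λ*(T)  for every T, with
-- the inequality between reals expressed through rational upper bounds.
Measurable : Pred 2^ω 0ℓ → Set₁
Measurable S = ∀ (T : Pred 2^ω 0ℓ) r → λ* T < r →
  ∃[ s ] ∃[ t ] s + t ≤ r × (λ* (T ∩ S) < s) × (λ* (T ∩ ∁ S) < t)

-- Points of 2^ω are equal when they agree pointwise; in the absence of
-- function extensionality a subset has to be required to respect this.
record Event : Set₁ where
  field
    member     : Pred 2^ω 0ℓ
    respects   : member Respects _≗_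
    measurable : Measurable member

open Event public

infix 4 _∈ᴱ_

_∈ᴱ_ : 2^ω → Event → Set
X ∈ᴱ 𝒜 = X ∈ member 𝒜

-- On measurable sets, Lebesgue measure is outer measure.
AlmostSure : Event → Set
AlmostSure 𝒜 = λ* member 𝒜 ≐ 1ℚ

------------------------------------------------------------------------
-- Turing reducibility, via Kleene's partial recursive functionals

data Code : ℕ → Set where
  zeroᶜ   : ∀ {n} → Code n
  sucᶜ    : Code 1
  projᶜ   : ∀ {n} → Fin n → Code n
  oracleᶜ : Code 1
  compᶜ   : ∀ {m n} → Code m → Vec (Code n) m → Code n
  precᶜ   : ∀ {n} → Code n → Code (2 ℕ.+ n) → Code (suc n)
  μᶜ      : ∀ {n} → Code (suc n) → Code n

bit : Bool → ℕ
bit b = if b then 1 else 0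

-- Y ⊢ e [ xs ]↓ y : the computation of e with oracle Y on input xs halts
-- with output y.
infix 4 _⊢_[_]↓_

data _⊢_[_]↓_ (Y : 2^ω) : ∀ {n} → Code n → Vec ℕ n → ℕ → Set where
  zero↓   : ∀ {n} {xs : Vec ℕ n} → Y ⊢ zeroᶜ [ xs ]↓ 0
  suc↓    : ∀ {x} → Y ⊢ sucᶜ [ x ∷ [] ]↓ suc x
  proj↓   : ∀ {n} {i : Fin n} {xs} → Y ⊢ projᶜ i [ xs ]↓ lookup xs i
  oracle↓ : ∀ {x} → Y ⊢ oracleᶜ [ x ∷ [] ]↓ bit (Y x)
  comp↓   : ∀ {m n} {f : Code m} {gs : Vec (Code n) m} {xs ys z} →
            (∀ i → Y ⊢ lookup gs i [ xs ]↓ lookup ys i) →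
            Y ⊢ f [ ys ]↓ z →
            Y ⊢ compᶜ f gs [ xs ]↓ z
  prec↓0  : ∀ {n} {f : Code n} {g xs z} →
            Y ⊢ f [ xs ]↓ z →
            Y ⊢ precᶜ f g [ 0 ∷ xs ]↓ z
  prec↓+  : ∀ {n} {f : Code n} {g xs k y z} →
            Y ⊢ precᶜ f g [ k ∷ xs ]↓ y →
            Y ⊢ g [ k ∷ y ∷ xs ]↓ z →
            Y ⊢ precᶜ f g [ suc k ∷ xs ]↓ z
  μ↓      : ∀ {n} {f : Code (suc n)} {xs k} →
            (∀ i → i ℕ.< k → ∃[ y ] Y ⊢ f [ i ∷ xs ]↓ suc y) →
            Y ⊢ f [ k ∷ xs ]↓ 0 →
            Y ⊢ μᶜ f [ xs ]↓ k

_≤T_ : 2^ω → 2^ω → Set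
Z ≤T Y = Σ[ e ∈ Code 1 ] ∀ n → Y ⊢ e [ n ∷ [] ]↓ bit (Z n)

{-# OPTIONS --safe #-}
-- Build trees of finite sets along which X is followed greedily. A finite set
-- s at stage n carries a Laver tree: infinitely many ways of adding a new
-- largest element, and so on. Laver trees have pure decision: given disjoint
-- open sets P and Q, some Laver subtree with the same root misses P or misses
-- Q. So the tree may be thinned until, for each of the first n functionals Φ
-- and all i < k, at most one value Φ(Y; i) is possible for Y following it.
-- Then s gets as successors finitely many of the s ∪ {i} in the tree, enough
-- for X to contain none of these i with probability at most 2^-k. As there
-- are finitely many s at stage n and k is at our disposal, the event D n that
-- X misses all successors of some s, or agrees up to k with one of the
-- predicted results, has probability at most 2^-(n+1).
--
-- By Borel–Cantelli, the X that are in D n for only finitely many n are an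
-- almost sure event 𝒜. Every stage also starts a new tree at the empty set, so
-- that such an X can be followed forever from some stage on. This gives an
-- infinite Y ⊆ X, and everything computable from Y is in D n for all large n.
module Submission where

open import Defs
open import Level using (0ℓ)
open import Axiom.ExcludedMiddle using (ExcludedMiddle)
open import Data.Bool using (Bool; true; false; T; _∨_; if_then_else_)
import Data.Bool.Properties as Bool
open import Data.Fin using (Fin; zero; suc; toℕ; fromℕ<)
import Data.Fin.Properties as Fin
import Data.Integer as ℤ
import Data.Integer.Properties as ℤ
open import Data.List using (List; []; _∷_; _++_; length; map; applyUpTo; upTo; allFin; replicate; concatMap; cartesianProduct; cartesianProductWith)
import Data.List.Properties as List
open import Data.List.Membership.Propositional using (_∈_; lose)
open import Data.List.Membership.Propositional.Properties using (∈-++⁺ˡ; ∈-++⁺ʳ; ∈-map⁺; ∈-concatMap⁺; ∈-cartesianProduct⁺; ∈-cartesianProductWith⁺; ∈-upTo⁺; ∈-allFin)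
open import Data.List.Relation.Unary.All as All using (All; []; _∷_)
open import Data.List.Relation.Unary.Any as Any using (Any; here; there)
import Data.List.Relation.Unary.Any.Properties as Any
open import Data.Maybe using (Maybe; just; nothing)
open import Data.Nat using (ℕ; zero; suc; _∸_; z≤n; s≤s)
import Data.Nat as ℕ
import Data.Nat.Properties as ℕ
open import Data.Product using (Σ-syntax; ∃-syntax; _×_; _,_; proj₁; proj₂)
open import Data.Rational using (ℚ; mkℚ; toℚᵘ; 0ℚ; 1ℚ; ½; _+_; _*_; _-_; -_; _≤_; _<_; *≤*; *<*; Positive; nonNegative)
open import Data.Rational.Properties
open import Data.Rational.Solver using (module +-*-Solver)
import Data.Rational.Unnormalised as ℚᵘ
open import Data.Rational.Unnormalised using (mkℚᵘ)
import Data.Rational.Unnormalised.Properties as ℚᵘ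
open import Data.Sum using (_⊎_; inj₁; inj₂)
open import Data.Unit using (⊤; tt)
open import Data.Vec using (Vec; []; _∷_; lookup)
open import Function using (_∘_; id; mk⇔)
open import Relation.Binary.Definitions using (_Respects_; tri<; tri≈; tri>)
open import Relation.Binary.PropositionalEquality
open import Relation.Nullary using (¬_; Dec; yes; no; does; contradiction)
open import Relation.Nullary.Decidable using (dec-true; dec-false; decidable-stable)
open import Relation.Unary using (Pred; _⊆_; ∁; ⋃)

open +-*-Solver using (solve; _:+_; _:-_; _:=_)

-- Rational series

½^_ : ℕ → ℚ
½^ zero  = 1ℚ
½^ suc k = ½ * ½^ k

halves : ∀ q → ½ * q + ½ * q ≡ q
halves q = trans (sym (*-distribʳ-+ q ½ ½)) (*-identityˡ q)

½*-mono-≤ : ∀ {p q} → p ≤ q → ½ * p ≤ ½ * q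
½*-mono-≤ = *-monoˡ-≤-nonNeg ½

½*-nonneg : ∀ {q} → 0ℚ ≤ q → 0ℚ ≤ ½ * q
½*-nonneg 0≤q = ≤-trans (≤-reflexive (sym (*-zeroʳ ½))) (½*-mono-≤ 0≤q)

p≤p+q : ∀ {p q} → 0ℚ ≤ q → p ≤ p + q
p≤p+q {p} {q} 0≤q = subst (_≤ p + q) (+-identityʳ p) (+-monoʳ-≤ p 0≤q)

½*q≤q : ∀ {q} → 0ℚ ≤ q → ½ * q ≤ q
½*q≤q {q} 0≤q = subst (½ * q ≤_) (halves q) (p≤p+q (½*-nonneg 0≤q))

½^-nonneg : ∀ k → 0ℚ ≤ ½^ k
½^-nonneg zero    = *≤* (ℤ.+≤+ z≤n)
½^-nonneg (suc k) = ½*-nonneg (½^-nonneg k)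

½^-+ : ∀ k l → ½^ (k ℕ.+ l) ≡ ½^ k * ½^ l
½^-+ zero    l = sym (*-identityˡ (½^ l))
½^-+ (suc k) l = trans (cong (½ *_) (½^-+ k l)) (sym (*-assoc ½ (½^ k) (½^ l)))

infixl 7 _×ℚ_

_×ℚ_ : ℕ → ℚ → ℚ
zero  ×ℚ q = 0ℚ
suc n ×ℚ q = q + n ×ℚ q

-- This is n ≤ 2^n scaled by `q`. One of the n + 1 copies is at most `½ * q`, and the others are
-- bounded by the induction hypothesis for `½ * q`.
n×½^n*q≤q : ∀ n {q} → 0ℚ ≤ q → n ×ℚ (½^ n * q) ≤ q
n×½^n*q≤q zero    0≤q = 0≤q
n×½^n*q≤q (suc n) {q} 0≤q = begin
  ½ * ½^ n * q + n ×ℚ (½ * ½^ n * q)    ≡⟨ cong₂ (λ p r → p + n ×ℚ r) (*-assoc ½ (½^ n) q) (shift (½^ n)) ⟩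
  ½ * (½^ n * q) + n ×ℚ (½^ n * (½ * q))  ≤⟨ +-mono-≤ (½*-mono-≤ (½^*q≤q n)) (n×½^n*q≤q n (½*-nonneg 0≤q)) ⟩
  ½ * q + ½ * q                         ≡⟨ halves q ⟩
  q                                     ∎
  where
  open ≤-Reasoning
  shift : ∀ h → ½ * h * q ≡ h * (½ * q)
  shift h = trans (cong (_* q) (*-comm ½ h)) (*-assoc h ½ q)
  ½^*q≤q : ∀ k → ½^ k * q ≤ q
  ½^*q≤q zero    = ≤-reflexive (*-identityˡ q)
  ½^*q≤q (suc k) = ≤-trans (≤-reflexive (*-assoc ½ (½^ k) q))
    (≤-trans (½*-mono-≤ (½^*q≤q k)) (½*q≤q 0≤q))

×ℚ-*-assoc : ∀ m n q → m ×ℚ (n ×ℚ q) ≡ (m ℕ.* n) ×ℚ q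
×ℚ-*-assoc zero    n q = refl
×ℚ-*-assoc (suc m) n q = trans (cong (n ×ℚ q +_) (×ℚ-*-assoc m n q)) (sym (×ℚ-+ n (m ℕ.* n)))
  where
  ×ℚ-+ : ∀ k l → (k ℕ.+ l) ×ℚ q ≡ k ×ℚ q + l ×ℚ q
  ×ℚ-+ zero    l = sym (+-identityˡ (l ×ℚ q))
  ×ℚ-+ (suc k) l = trans (cong (q +_) (×ℚ-+ k l)) (sym (+-assoc q (k ×ℚ q) (l ×ℚ q)))

×ℚ≡* : ∀ n q → n ×ℚ q ≡ n ×ℚ 1ℚ * q
×ℚ≡* zero    q = sym (*-zeroˡ q)
×ℚ≡* (suc n) q = trans
  (cong₂ _+_ (sym (*-identityˡ q)) (×ℚ≡* n q))
  (sym (*-distribʳ-+ q 1ℚ (n ×ℚ 1ℚ)))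

∑-cons : ∀ n f → ∑[i< suc n ] f ≡ f 0 + ∑[i< n ] (f ∘ suc)
∑-cons zero    f = +-comm 0ℚ (f 0)
∑-cons (suc n) f = trans (cong (_+ f (suc n)) (∑-cons n f)) (+-assoc (f 0) _ _)

∑-mono : ∀ n {f g : ℕ → ℚ} → (∀ i → f i ≤ g i) → ∑[i< n ] f ≤ ∑[i< n ] g
∑-mono zero    f≤g = ≤-refl
∑-mono (suc n) f≤g = +-mono-≤ (∑-mono n f≤g) (f≤g n)

∑-nonneg : ∀ n {f} → (∀ i → 0ℚ ≤ f i) → 0ℚ ≤ ∑[i< n ] f
∑-nonneg zero    0≤f = ≤-refl
∑-nonneg (suc n) 0≤f = +-mono-≤ (∑-nonneg n 0≤f) (0≤f n)

∑-+ : ∀ n f g → ∑[i< n ] (λ i → f i + g i) ≡ ∑[i< n ] f + ∑[i< n ] g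
∑-+ zero    f g = refl
∑-+ (suc n) f g = trans (cong (_+ (f n + g n)) (∑-+ n f g))
  (solve 4 (λ a b c d → (a :+ b) :+ (c :+ d) := (a :+ c) :+ (b :+ d)) refl (∑[i< n ] f) (∑[i< n ] g) (f n) (g n))

∑-½* : ∀ n f → ∑[i< n ] (λ i → ½ * f i) ≡ ½ * ∑[i< n ] f
∑-½* zero    f = sym (*-zeroʳ ½)
∑-½* (suc n) f = trans (cong (_+ ½ * f n) (∑-½* n f)) (sym (*-distribˡ-+ ½ (∑[i< n ] f) (f n)))

∑-monoˡ : ∀ {f m n} → (∀ i → 0ℚ ≤ f i) → m ℕ.≤ n → ∑[i< m ] f ≤ ∑[i< n ] f
∑-monoˡ {n = n} 0≤f z≤n = ∑-nonneg n 0≤f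
∑-monoˡ {f} 0≤f (s≤s {m} {n} m≤n) = begin
  ∑[i< suc m ] f             ≡⟨ ∑-cons m f ⟩
  f 0 + ∑[i< m ] (f ∘ suc)   ≤⟨ +-monoʳ-≤ (f 0) (∑-monoˡ (0≤f ∘ suc) m≤n) ⟩
  f 0 + ∑[i< n ] (f ∘ suc)   ≡⟨ ∑-cons n f ⟨
  ∑[i< suc n ] f             ∎
  where open ≤-Reasoning

∑-geometric : ∀ m n → ∑[i< n ] (λ i → ½^ suc (i ℕ.+ m)) ≤ ½^ m
∑-geometric m n = ≤-trans (p≤p+q (½^-nonneg (n ℕ.+ m))) (≤-reflexive (exact n))
  where
  -- With the remainder `½^ (n ℕ.+ m)` added, the partial sum does not depend on n.
  exact : ∀ n → ∑[i< n ] (λ i → ½^ suc (i ℕ.+ m)) + ½^ (n ℕ.+ m) ≡ ½^ m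
  exact zero    = +-identityˡ (½^ m)
  exact (suc n) = trans (+-assoc (∑[i< n ] (λ i → ½^ suc (i ℕ.+ m))) (½^ suc (n ℕ.+ m)) (½^ suc (n ℕ.+ m)))
    (trans (cong (∑[i< n ] (λ i → ½^ suc (i ℕ.+ m)) +_) (halves (½^ (n ℕ.+ m)))) (exact n))

0<q-p : ∀ {p q} → p < q → 0ℚ < q - p
0<q-p {p} {q} p<q = subst (_< q - p) (+-inverseʳ p) (+-monoˡ-< (- p) p<q)

p+[q-p]≡q : ∀ p q → p + (q - p) ≡ q
p+[q-p]≡q p q = solve 2 (λ p q → p :+ (q :- p) := q) refl p q

n×1≃n : ∀ n → toℚᵘ (n ×ℚ 1ℚ) ℚᵘ.≃ mkℚᵘ (ℤ.+ n) 0
n×1≃n zero    = ℚᵘ.*≡* refl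
n×1≃n (suc n) = ℚᵘ.≃-trans (toℚᵘ-homo-+ 1ℚ (n ×ℚ 1ℚ))
  (ℚᵘ.≃-trans (ℚᵘ.+-congʳ (toℚᵘ 1ℚ) (n×1≃n n))
    (ℚᵘ.*≡* (cong (ℤ._* ℤ.1ℤ) (cong (λ k → ℤ.1ℤ ℤ.+ k) (ℤ.*-identityʳ (ℤ.+ n))))))

-- A positive fraction with denominator d + 1 is at least 1/(d + 1), hence at least 2^-(d+1).
½^-archimedean : ∀ {ε} → 0ℚ < ε → ∃[ k ] ½^ k ≤ ε
½^-archimedean {mkℚ (ℤ.+ zero) d _} (*<* (ℤ.+<+ ()))
½^-archimedean {ε@(mkℚ (ℤ.+ suc n) d _)} (*<* _) =
  suc d , *-cancelˡ-≤-pos (suc d ×ℚ 1ℚ) (begin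
    suc d ×ℚ 1ℚ * ½^ suc d    ≡⟨ ×ℚ≡* (suc d) (½^ suc d) ⟨
    suc d ×ℚ (½^ suc d)       ≡⟨ cong (suc d ×ℚ_) (*-identityʳ (½^ suc d)) ⟨
    suc d ×ℚ (½^ suc d * 1ℚ)  ≤⟨ n×½^n*q≤q (suc d) (½^-nonneg 0) ⟩
    1ℚ                        ≤⟨ 1≤ ⟩
    suc d ×ℚ 1ℚ * ε           ∎)
  where
  open ≤-Reasoning
  ×ℚ-nonneg : ∀ k → 0ℚ ≤ k ×ℚ 1ℚ
  ×ℚ-nonneg zero    = ≤-refl
  ×ℚ-nonneg (suc k) = +-mono-≤ (½^-nonneg 0) (×ℚ-nonneg k)
  instance
    pos : Positive (suc d ×ℚ 1ℚ)
    pos = pos+nonNeg⇒pos 1ℚ (d ×ℚ 1ℚ) {{nonNegative (×ℚ-nonneg d)}}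
  1≤ : 1ℚ ≤ suc d ×ℚ 1ℚ * ε
  1≤ = toℚᵘ-cancel-≤ (ℚᵘ.≤-respʳ-≃
    (ℚᵘ.≃-sym (ℚᵘ.≃-trans (toℚᵘ-homo-* (suc d ×ℚ 1ℚ) ε) (ℚᵘ.*-congʳ {toℚᵘ ε} (n×1≃n (suc d)))))
    (ℚᵘ.*≤* (ℤ.+≤+ (ℕ.≤-trans
      (ℕ.≤-reflexive (trans (ℕ.+-identityʳ _) (cong suc (ℕ.+-identityʳ d))))
      (ℕ.≤-trans (ℕ.m≤m*n (suc d) (suc n)) (ℕ.≤-reflexive (sym (ℕ.*-identityʳ _))))))))
½^-archimedean {mkℚ ℤ.-[1+ n ] d _} (*<* ())

-- Fair-coin measure

cylinderMeasure-nonneg : ∀ σ → 0ℚ ≤ cylinderMeasure σ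
cylinderMeasure-nonneg []      = ½^-nonneg 0
cylinderMeasure-nonneg (_ ∷ σ) = ½*-nonneg (cylinderMeasure-nonneg σ)

cylinderMeasure≡½^length : ∀ σ → cylinderMeasure σ ≡ ½^ length σ
cylinderMeasure≡½^length []      = refl
cylinderMeasure≡½^length (_ ∷ σ) = cong (½ *_) (cylinderMeasure≡½^length σ)

Covered : List (List Bool) → Pred 2^ω 0ℓ
Covered L X = Any (λ σ → Cylinder σ X) L

μ : List (List Bool) → ℚ
μ []      = 0ℚ
μ (σ ∷ L) = cylinderMeasure σ + μ L

μ-nonneg : ∀ L → 0ℚ ≤ μ L
μ-nonneg []      = ≤-refl
μ-nonneg (σ ∷ L) = +-mono-≤ (cylinderMeasure-nonneg σ) (μ-nonneg L)

μ-++ : ∀ L M → μ (L ++ M) ≡ μ L + μ M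
μ-++ []      M = sym (+-identityˡ (μ M))
μ-++ (σ ∷ L) M = trans (cong (cylinderMeasure σ +_) (μ-++ L M))
  (sym (+-assoc (cylinderMeasure σ) (μ L) (μ M)))

μ-map-∷ : ∀ b L → μ (map (b ∷_) L) ≡ ½ * μ L
μ-map-∷ b []      = sym (*-zeroʳ ½)
μ-map-∷ b (σ ∷ L) = trans (cong (½ * cylinderMeasure σ +_) (μ-map-∷ b L))
  (sym (*-distribˡ-+ ½ (cylinderMeasure σ) (μ L)))

μ-concatMap : ∀ {a} {A : Set a} {f : A → List (List Bool)} {r} →
              (∀ x → μ (f x) ≤ r) → ∀ xs → μ (concatMap f xs) ≤ length xs ×ℚ r
μ-concatMap         μf≤r []       = ≤-refl
μ-concatMap {f = f} μf≤r (x ∷ xs) = ≤-trans (≤-reflexive (μ-++ (f x) (concatMap f xs)))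
  (+-mono-≤ (μf≤r x) (μ-concatMap μf≤r xs))

μ-map : ∀ {a} {A : Set a} {f : A → List Bool} {r} →
        (∀ x → cylinderMeasure (f x) ≤ r) → ∀ xs → μ (map f xs) ≤ length xs ×ℚ r
μ-map f≤r []       = ≤-refl
μ-map f≤r (x ∷ xs) = +-mono-≤ (f≤r x) (μ-map f≤r xs)

-- The sets disjoint from F below n, as a union of cylinders.
avoid : 2^ω → ℕ → List (List Bool)
avoid F zero    = [] ∷ []
avoid F (suc n) = map (false ∷_) (avoid (F ∘ suc) n) ++
  (if F 0 then [] else map (true ∷_) (avoid (F ∘ suc) n))

avoid-covers : ∀ F n X → (∀ i → i ℕ.< n → F i ≡ true → X i ≡ false) → Covered (avoid F n) X
avoid-covers F zero    X disj = here refl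
avoid-covers F (suc n) X disj
  with X 0 in X0 | F 0 in F0 | avoid-covers (F ∘ suc) n (X ∘ suc) (λ i i<n → disj (suc i) (s≤s i<n))
... | false | _     | covered = Any.++⁺ˡ (Any.map⁺ (Any.map (cong₂ _∷_ X0) covered))
... | true  | false | covered = Any.++⁺ʳ (map (false ∷_) (avoid (F ∘ suc) n))
  (Any.map⁺ (Any.map (cong₂ _∷_ X0) covered))
... | true  | true  | _       = contradiction (trans (sym X0) (disj 0 (s≤s z≤n) F0)) λ ()

μ-avoid-∈ : ∀ F n → F 0 ≡ true → μ (avoid F (suc n)) ≡ ½ * μ (avoid (F ∘ suc) n)
μ-avoid-∈ F n F0 rewrite F0 =
  trans (cong μ (List.++-identityʳ (map (false ∷_) A))) (μ-map-∷ false A)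
  where A = avoid (F ∘ suc) n

μ-avoid-∉ : ∀ F n → F 0 ≡ false → μ (avoid F (suc n)) ≡ μ (avoid (F ∘ suc) n)
μ-avoid-∉ F n F0 rewrite F0 = trans (μ-++ (map (false ∷_) A) (map (true ∷_) A))
  (trans (cong₂ _+_ (μ-map-∷ false A) (μ-map-∷ true A)) (halves (μ A)))
  where A = avoid (F ∘ suc) n

μ-avoid-suc : ∀ F n → μ (avoid F (suc n)) ≤ μ (avoid (F ∘ suc) n)
μ-avoid-suc F n with Bool._≟_ (F 0) true
... | yes F0 = ≤-trans (≤-reflexive (μ-avoid-∈ F n F0)) (½*q≤q (μ-nonneg (avoid (F ∘ suc) n)))
... | no ¬F0 = ≤-reflexive (μ-avoid-∉ F n (Bool.¬-not ¬F0))

-- Each element of `F` that is passed halves the measure, and each non-element preserves it. The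
-- helper `from` walks to the element `i` and then asks for `k` further halvings.
μ-avoid-small : ∀ k F → Infinite F → ∃[ n ] μ (avoid F n) ≤ ½^ k
μ-avoid-small zero    F inf = 0 , ≤-reflexive (+-identityʳ 1ℚ)
μ-avoid-small (suc k) F inf = from (proj₁ (inf 0)) F (proj₂ (proj₂ (inf 0))) inf
  where
  tail-infinite : ∀ {G} → Infinite G → Infinite (G ∘ suc)
  tail-infinite inf n with inf (suc n)
  ... | suc m , s≤s n≤m , m∈G = m , n≤m , m∈G
  from : ∀ i G → G i ≡ true → Infinite G → ∃[ n ] μ (avoid G n) ≤ ½^ suc k
  from zero    G G0 inf with μ-avoid-small k (G ∘ suc) (tail-infinite {G} inf)
  ... | n , μ≤ = suc n , ≤-trans (≤-reflexive (μ-avoid-∈ G n G0)) (½*-mono-≤ μ≤)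
  from (suc i) G Gi inf with from i (G ∘ suc) Gi (tail-infinite {G} inf)
  ... | n , μ≤ = suc n , ≤-trans (μ-avoid-suc G n) μ≤

-- Enumeration of the blocks  x ∷ xs,  h 0 ∷ D 0,  h 1 ∷ D 1, … ; the heads
-- keep the blocks from being empty.
emit : ∀ {A : Set} → A → List A → (ℕ → A) → (ℕ → List A) → ℕ → A
emit x xs       h D zero    = x
emit x []       h D (suc i) = emit (h 0) (D 0) (h ∘ suc) (D ∘ suc) i
emit x (y ∷ xs) h D (suc i) = emit y xs h D i

flatten : ∀ {A : Set} → (ℕ → A) → (ℕ → List A) → ℕ → A
flatten h D = emit (h 0) (D 0) (h ∘ suc) (D ∘ suc)

module _ {A : Set} {P : Pred A 0ℓ} where

  emit-∈-first : ∀ x {xs h D} → Any P xs → ∃[ i ] P (emit x xs h D i)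
  emit-∈-first x (here p)        = 1 , p
  emit-∈-first x (there {y} any) with emit-∈-first y any
  ... | i , p = suc i , p

  emit-∈ : ∀ j x xs {h D} → P (h j) ⊎ Any P (D j) → ∃[ i ] P (emit x xs h D i)
  emit-∈ j       x (y ∷ xs)   any with emit-∈ j y xs any
  ... | i , p = suc i , p
  emit-∈ zero    x []         (inj₁ p)   = 1 , p
  emit-∈ zero    x [] {h} {D} (inj₂ any) with emit-∈-first (h 0) any
  ... | i , p = suc i , p
  emit-∈ (suc j) x [] {h} {D} any with emit-∈ j (h 0) (D 0) any
  ... | i , p = suc i , p

  flatten-∈ : ∀ h D j → P (h j) ⊎ Any P (D j) → ∃[ i ] P (flatten h D i)
  flatten-∈ h D zero    (inj₁ p)   = 0 , p
  flatten-∈ h D zero    (inj₂ any) = emit-∈-first (h 0) any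
  flatten-∈ h D (suc j) any        = emit-∈ j (h 0) (D 0) any

-- No block is empty, so the first n terms lie in the current block and the n blocks after it.
∑-emit : ∀ n x xs h D → ∑[i< n ] (cylinderMeasure ∘ emit x xs h D) ≤
         μ (x ∷ xs) + ∑[i< n ] (λ j → μ (h j ∷ D j))
∑-emit zero    x xs h D = ≤-trans (μ-nonneg (x ∷ xs)) (≤-reflexive (sym (+-identityʳ (μ (x ∷ xs)))))
∑-emit (suc n) x [] h D = begin
  ∑[i< suc n ] (cylinderMeasure ∘ emit x [] h D)                 ≡⟨ ∑-cons n _ ⟩
  cx + ∑[i< n ] (cylinderMeasure ∘ flatten h D)                  ≤⟨ +-monoʳ-≤ cx (∑-emit n (h 0) (D 0) (h ∘ suc) (D ∘ suc)) ⟩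
  cx + (w 0 + ∑[i< n ] (w ∘ suc))                                ≡⟨ cong₂ _+_ (+-identityʳ cx) (∑-cons n w) ⟨
  μ (x ∷ []) + ∑[i< suc n ] w                                    ∎
  where
  open ≤-Reasoning
  w = λ j → μ (h j ∷ D j)
  cx = cylinderMeasure x
∑-emit (suc n) x (y ∷ xs) h D = begin
  ∑[i< suc n ] (cylinderMeasure ∘ emit x (y ∷ xs) h D)           ≡⟨ ∑-cons n _ ⟩
  cx + ∑[i< n ] (cylinderMeasure ∘ emit y xs h D)                ≤⟨ +-monoʳ-≤ cx (∑-emit n y xs h D) ⟩
  cx + (μ (y ∷ xs) + ∑[i< n ] w)                                 ≡⟨ +-assoc cx (μ (y ∷ xs)) (∑[i< n ] w) ⟨
  μ (x ∷ y ∷ xs) + ∑[i< n ] w                                    ≤⟨ +-monoʳ-≤ (μ (x ∷ y ∷ xs)) (p≤p+q (μ-nonneg (h n ∷ D n))) ⟩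
  μ (x ∷ y ∷ xs) + ∑[i< suc n ] w                                ∎
  where
  open ≤-Reasoning
  w = λ j → μ (h j ∷ D j)
  cx = cylinderMeasure x

∑-flatten : ∀ {p q} h D → (∀ n → ∑[i< n ] (cylinderMeasure ∘ h) ≤ p) → (∀ n → ∑[i< n ] (μ ∘ D) ≤ q) →
            ∀ n → ∑[i< n ] (cylinderMeasure ∘ flatten h D) ≤ p + q
∑-flatten {p} {q} h D ∑h≤p ∑D≤q n = begin
  ∑[i< n ] (cylinderMeasure ∘ flatten h D)                       ≤⟨ ∑-emit n (h 0) (D 0) (h ∘ suc) (D ∘ suc) ⟩
  μ (h 0 ∷ D 0) + ∑[i< n ] (λ j → μ (h (suc j) ∷ D (suc j)))     ≡⟨ ∑-cons n (λ j → μ (h j ∷ D j)) ⟨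
  ∑[i< suc n ] (λ j → μ (h j ∷ D j))                             ≡⟨ ∑-+ (suc n) (cylinderMeasure ∘ h) (μ ∘ D) ⟩
  ∑[i< suc n ] (cylinderMeasure ∘ h) + ∑[i< suc n ] (μ ∘ D)      ≤⟨ +-mono-≤ (∑h≤p (suc n)) (∑D≤q (suc n)) ⟩
  p + q                                                          ∎
  where open ≤-Reasoning

-- Cylinders of total measure at most `½^ m`, used where an infinite sequence is required but
-- nothing remains to be covered.
filler : ℕ → ℕ → List Bool
filler m i = replicate (suc (i ℕ.+ m)) false

∑-filler : ∀ m n → ∑[i< n ] (cylinderMeasure ∘ filler m) ≤ ½^ m
∑-filler m n = ≤-trans (∑-mono n (λ i → ≤-reflexive (trans
    (cylinderMeasure≡½^length (filler m i)) (cong ½^_ (List.length-replicate (suc (i ℕ.+ m)))))))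
  (∑-geometric m n)

Cylinder-≗ : ∀ σ → Cylinder σ Respects _≗_
Cylinder-≗ []      X≗Y _ = refl
Cylinder-≗ (b ∷ σ) X≗Y X∈ = cong₂ _∷_
  (trans (sym (X≗Y 0)) (List.∷-injectiveˡ X∈)) (Cylinder-≗ σ (X≗Y ∘ suc) (List.∷-injectiveʳ X∈))

Covered-≗ : ∀ L → Covered L Respects _≗_
Covered-≗ L X≗Y = Any.map (λ {σ} → Cylinder-≗ σ X≗Y)

-- The trace of a cylinder on the sets with a given initial segment;
-- nothing stands for the empty trace.
weight : Maybe (List Bool) → ℚ
weight nothing  = 0ℚ
weight (just σ) = cylinderMeasure σ

restrict : Bool → Maybe (List Bool) → Maybe (List Bool)
restrict b     nothing            = nothing
restrict b     (just [])          = just []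
restrict false (just (false ∷ σ)) = just σ
restrict false (just (true  ∷ σ)) = nothing
restrict true  (just (false ∷ σ)) = nothing
restrict true  (just (true  ∷ σ)) = just σ

restrict-∷ : ∀ b σ → restrict b (just (b ∷ σ)) ≡ just σ
restrict-∷ false σ = refl
restrict-∷ true  σ = refl

weight-nonneg : ∀ s → 0ℚ ≤ weight s
weight-nonneg nothing  = ≤-refl
weight-nonneg (just σ) = cylinderMeasure-nonneg σ

weight-restrict : ∀ s → weight s ≡ ½ * (weight (restrict false s) + weight (restrict true s))
weight-restrict nothing            = refl
weight-restrict (just [])          = refl
weight-restrict (just (false ∷ σ)) = cong (½ *_) (sym (+-identityʳ (cylinderMeasure σ)))
weight-restrict (just (true ∷ σ))  = cong (½ *_) (sym (+-identityˡ (cylinderMeasure σ)))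

-- The whole space has outer measure at least 1

module Classical (em : ExcludedMiddle 0ℓ) where

  ¬∀⇒∃¬ : {A : Set} {P : A → Set} → ¬ (∀ x → P x) → ∃[ x ] ¬ P x
  ¬∀⇒∃¬ {A} {P} ¬∀ with em {∃[ x ] ¬ P x}
  ... | yes ∃¬ = ∃¬
  ... | no ¬∃¬ = contradiction (λ x → decidable-stable em (λ ¬p → ¬∃¬ (x , ¬p))) ¬∀

  module _ {q : ℚ} where

    Small : (ℕ → Maybe (List Bool)) → Set
    Small C = ∀ n → ∑[i< n ] (weight ∘ C) ≤ q

    -- A partial sum is the average of the corresponding sums for the two halves. If both halves
    -- exceeded `q`, they would do so together at the later of the two stages, and so would the
    -- average.
    small-half : ∀ C → Small C → Σ[ b ∈ Bool ] Small (restrict b ∘ C)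
    small-half C small with em {Small (restrict false ∘ C)} | em {Small (restrict true ∘ C)}
    ... | yes s | _     = false , s
    ... | no ¬s | yes t = true , t
    ... | no ¬s | no ¬t with ¬∀⇒∃¬ ¬s | ¬∀⇒∃¬ ¬t
    ... | n₀ , s>q | n₁ , t>q = contradiction (<-≤-trans q<∑ (small N)) (<-irrefl refl)
      where
      N = n₀ ℕ.⊔ n₁
      half : Bool → ℕ → ℚ
      half b i = weight (restrict b (C i))
      large : ∀ b {n} → n ℕ.≤ N → ¬ (∑[i< n ] (half b) ≤ q) → q < ∑[i< N ] (half b)
      large b n≤N ∑≰q = <-≤-trans (≰⇒> ∑≰q) (∑-monoˡ (λ i → weight-nonneg (restrict b (C i))) n≤N)
      open ≤-Reasoning
      q<∑ : q < ∑[i< N ] (weight ∘ C)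
      q<∑ = begin-strict
        q                                                        ≡⟨ trans (*-distribˡ-+ ½ q q) (halves q) ⟨
        ½ * (q + q)                                              <⟨ *-monoʳ-<-pos ½ (+-mono-< (large false (ℕ.m≤m⊔n n₀ n₁) s>q) (large true (ℕ.m≤n⊔m n₀ n₁) t>q)) ⟩
        ½ * (∑[i< N ] (half false) + ∑[i< N ] (half true))       ≡⟨ cong (½ *_) (∑-+ N (half false) (half true)) ⟨
        ½ * ∑[i< N ] (λ i → half false i + half true i)          ≡⟨ ∑-½* N (λ i → half false i + half true i) ⟨
        ∑[i< N ] (λ i → ½ * (half false i + half true i))        ≤⟨ ∑-mono N (λ i → ≤-reflexive (sym (weight-restrict (C i)))) ⟩
        ∑[i< N ] (weight ∘ C)                                    ∎

    -- Branch into a half in which the cylinders still have total measure at most q.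
    uncovered : ∀ C → Small C → 2^ω
    uncovered C small zero    = proj₁ (small-half C small)
    uncovered C small (suc n) = uncovered (restrict (proj₁ (small-half C small)) ∘ C) (proj₂ (small-half C small)) n

    -- Were the branch in the cylinder, the trace would become the whole space once the digits of
    -- `σ` are used up. Its weight 1 exceeds `q`, which bounds all partial sums along the branch.
    uncovered-∉ : q < 1ℚ → ∀ σ C (small : Small C) i → C i ≡ just σ → ¬ Cylinder σ (uncovered C small)
    uncovered-∉ q<1 []      C small i Ci≡[] _ =
      contradiction (<-≤-trans q<1 (≤-trans 1≤∑ (small (suc i)))) (<-irrefl refl)
      where
      1≤∑ : 1ℚ ≤ ∑[i< suc i ] (weight ∘ C)
      1≤∑ = ≤-trans (≤-reflexive (trans (cong weight (sym Ci≡[])) (sym (+-identityˡ (weight (C i))))))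
        (+-monoˡ-≤ (weight (C i)) (∑-nonneg i (weight-nonneg ∘ C)))
    uncovered-∉ q<1 (b ∷ σ) C small i Ci≡ ∈ = uncovered-∉ q<1 σ (restrict (proj₁ (small-half C small)) ∘ C) (proj₂ (small-half C small)) i
      (trans (cong₂ restrict (List.∷-injectiveˡ ∈) Ci≡) (restrict-∷ b σ)) (List.∷-injectiveʳ ∈)

    -- If `q` were below 1, the branch `uncovered` would be a point outside all the cylinders.
    full-cover : ∀ C → (∀ X → ∃[ i ] Cylinder (C i) X) →
                 (∀ n → ∑[i< n ] (cylinderMeasure ∘ C) ≤ q) → 1ℚ ≤ q
    full-cover C covers ∑≤q = ≮⇒≥ λ q<1 →
      let i , ∈Ci = covers (uncovered (just ∘ C) ∑≤q)
      in uncovered-∉ q<1 (C i) (just ∘ C) ∑≤q i refl ∈Ci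

  -- The Borel-Cantelli lemma

  module EventuallyAvoiding (D : ℕ → List (List Bool)) (μD≤ : ∀ n → μ (D n) ≤ ½^ suc n) where

    Avoids : Pred 2^ω 0ℓ
    Avoids X = ∃[ m ] ∀ n → m ℕ.≤ n → ¬ Covered (D n) X

    tail : ℕ → ℕ → List (List Bool)
    tail m i = D (i ℕ.+ m)

    tail-measure : ∀ m n → ∑[i< n ] (μ ∘ tail m) ≤ ½^ m
    tail-measure m n = ≤-trans (∑-mono n (λ i → μD≤ (i ℕ.+ m))) (∑-geometric m n)

    tail-covers : ∀ {X} m → ¬ Avoids X → ∃[ j ] Covered (tail m j) X
    tail-covers {X} m ∉ = decidable-stable em λ ¬∃ →
      ∉ (m , λ n m≤n covered → ¬∃ (n ∸ m , subst (λ k → Covered (D k) X) (sym (ℕ.m∸n+n≡m m≤n)) covered))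

    -- For every m, the lists `D n` with n ≥ m cover the complement of `Avoids` at a cost of at most
    -- `½^ m`.
    null : ∀ {S ε} → S ⊆ ∁ Avoids → 0ℚ < ε → λ* S < ε
    null {S} {ε} S⊆ 0<ε with <-dense 0<ε
    ... | δ , 0<δ , δ<ε with ½^-archimedean 0<δ
    ... | k , ½^k≤δ = flatten (filler m) (tail m) , covers , δ , δ<ε , λ n →
      ≤-trans (∑-flatten (filler m) (tail m) (∑-filler m) (tail-measure m) n)
        (≤-trans (≤-reflexive (halves (½^ k))) ½^k≤δ)
      where
      -- The fillers and the tail of `D` each take half of `½^ k`.
      m = suc k
      covers : S ⊆ ⋃ ℕ (λ i → Cylinder (flatten (filler m) (tail m) i))
      covers X∈S with tail-covers m (S⊆ X∈S)
      ... | j , covered = flatten-∈ {P = λ σ → Cylinder σ _} (filler m) (tail m) j (inj₂ covered)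

    -- The slack between `q` and `r` is split at `s`: the cover of `T` also serves the part inside
    -- `Avoids`, and the null part outside receives `r - s`.
    measurable-Avoids : Measurable Avoids
    measurable-Avoids T r (C , T⊆ , q , q<r , ∑≤q) with <-dense q<r
    ... | s , q<s , s<r = s , r - s , ≤-reflexive (p+[q-p]≡q s r) ,
      (C , (T⊆ ∘ proj₁) , q , q<s , ∑≤q) , null proj₂ (0<q-p s<r)

    event : Event
    event = record
      { member     = Avoids
      ; respects   = λ X≗Y (m , avoids) → m , λ n m≤n covered →
          avoids n m≤n (Covered-≗ (D n) (sym ∘ X≗Y) covered)
      ; measurable = measurable-Avoids
      }

    -- Joined with a tail of `D` of measure at most `s - q`, a cover of `Avoids` covers the whole
    -- space, so that 1 ≤ s < r.
    outer≥1 : ∀ {r} → λ* Avoids < r → 1ℚ < r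
    outer≥1 {r} (C , covers , q , q<r , ∑≤q) with <-dense q<r
    ... | s , q<s , s<r with ½^-archimedean (0<q-p q<s)
    ... | m , ½^m≤ = ≤-<-trans (≤-trans
        (full-cover (flatten C (tail m)) all-covered (∑-flatten C (tail m) ∑≤q (tail-measure m)))
        (≤-trans (+-monoʳ-≤ q ½^m≤) (≤-reflexive (p+[q-p]≡q q s)))) s<r
      where
      all-covered : ∀ X → ∃[ i ] Cylinder (flatten C (tail m) i) X
      all-covered X with em {Avoids X}
      ... | yes X∈ = flatten-∈ {P = λ σ → Cylinder σ X} C (tail m) (proj₁ (covers X∈)) (inj₁ (proj₂ (covers X∈)))
      ... | no  X∉ with tail-covers m X∉
      ... | j , covered = flatten-∈ {P = λ σ → Cylinder σ _} C (tail m) j (inj₂ covered)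

    -- The cylinder of the empty string covers everything; fillers of total measure at most `s - 1`
    -- complete the sequence.
    outer≤1 : ∀ {r} → 1ℚ < r → λ* Avoids < r
    outer≤1 {r} 1<r with <-dense 1<r
    ... | s , 1<s , s<r with ½^-archimedean (0<q-p 1<s)
    ... | m , ½^m≤ = C , (λ _ → 0 , refl) , s , s<r , λ n → begin
        ∑[i< n ] (cylinderMeasure ∘ C)                   ≤⟨ p≤p+q (cylinderMeasure-nonneg (C n)) ⟩
        ∑[i< suc n ] (cylinderMeasure ∘ C)               ≡⟨ ∑-cons n (cylinderMeasure ∘ C) ⟩
        1ℚ + ∑[i< n ] (cylinderMeasure ∘ filler m)       ≤⟨ +-monoʳ-≤ 1ℚ (≤-trans (∑-filler m n) ½^m≤) ⟩
        1ℚ + (s - 1ℚ)                                    ≡⟨ p+[q-p]≡q 1ℚ s ⟩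
        s                                                ∎
      where
      open ≤-Reasoning
      C : ℕ → List Bool
      C zero    = []
      C (suc i) = filler m i

    event-almostSure : AlmostSure event
    event-almostSure r = mk⇔ outer≥1 outer≤1

-- Turing functionals

bit-injective : ∀ {b c} → bit b ≡ bit c → b ≡ c
bit-injective {false} {false} _ = refl
bit-injective {true}  {true}  _ = refl

lookup-injective : ∀ {A : Set} {m} (xs ys : Vec A m) → (∀ i → lookup xs i ≡ lookup ys i) → xs ≡ ys
lookup-injective []       []       _  = refl
lookup-injective (x ∷ xs) (y ∷ ys) eq = cong₂ _∷_ (eq zero) (lookup-injective xs ys (eq ∘ suc))

↓-functional : ∀ {Y n} {e : Code n} {xs y z} → Y ⊢ e [ xs ]↓ y → Y ⊢ e [ xs ]↓ z → y ≡ z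
↓-functional zero↓         zero↓           = refl
↓-functional suc↓          suc↓            = refl
↓-functional proj↓         proj↓           = refl
↓-functional oracle↓       oracle↓         = refl
↓-functional {Y} (comp↓ {f = f} {ys = ys} {z} gs↓ f↓) (comp↓ {ys = ys′} gs↓′ f↓′) =
  ↓-functional f↓ (subst (λ v → Y ⊢ f [ v ]↓ _)
    (sym (lookup-injective ys ys′ (λ i → ↓-functional (gs↓ i) (gs↓′ i)))) f↓′)
↓-functional (prec↓0 f↓)   (prec↓0 f↓′)    = ↓-functional f↓ f↓′
↓-functional (prec↓+ r↓ g↓) (prec↓+ r↓′ g↓′) with ↓-functional r↓ r↓′
... | refl = ↓-functional g↓ g↓′
↓-functional (μ↓ {k = k} below zero↓k) (μ↓ {k = k′} below′ zero↓k′) with ℕ.<-cmp k k′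
... | tri≈ _ k≡k′ _ = k≡k′
... | tri< k<k′ _ _ = contradiction (↓-functional zero↓k (proj₂ (below′ k k<k′))) λ ()
... | tri> _ _ k′<k = contradiction (↓-functional (proj₂ (below k′ k′<k)) zero↓k′) λ ()

AgreeBelow : ℕ → 2^ω → 2^ω → Set
AgreeBelow N Y Y′ = ∀ x → x ℕ.< N → Y x ≡ Y′ x

agree-≤ : ∀ {M N Y Y′} → M ℕ.≤ N → AgreeBelow N Y Y′ → AgreeBelow M Y Y′
agree-≤ M≤N agree x x<M = agree x (ℕ.<-≤-trans x<M M≤N)

Fin-bound : ∀ {m} (f : Fin m → ℕ) → ∃[ N ] ∀ i → f i ℕ.≤ N
Fin-bound {zero}  f = 0 , λ ()
Fin-bound {suc m} f with Fin-bound (f ∘ suc)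
... | N , f≤N = f zero ℕ.⊔ N , λ { zero → ℕ.m≤m⊔n (f zero) N ; (suc i) → ℕ.≤-trans (f≤N i) (ℕ.m≤n⊔m (f zero) N) }

-- The use principle: a halting computation consults its oracle finitely often, and N exceeds every
-- number it asks about.
use : ∀ {Y n} {e : Code n} {xs y} → Y ⊢ e [ xs ]↓ y →
      ∃[ N ] ∀ Y′ → AgreeBelow N Y Y′ → Y′ ⊢ e [ xs ]↓ y
use zero↓   = 0 , λ _ _ → zero↓
use suc↓    = 0 , λ _ _ → suc↓
use proj↓   = 0 , λ _ _ → proj↓
use (oracle↓ {x}) = suc x , λ Y′ agree →
  subst (λ b → Y′ ⊢ oracleᶜ [ x ∷ [] ]↓ bit b) (sym (agree x ℕ.≤-refl)) oracle↓
use (comp↓ gs↓ f↓) with Fin-bound (λ i → proj₁ (use (gs↓ i))) | use f↓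
... | M , ≤M | N , f-use = M ℕ.⊔ N , λ Y′ agree → comp↓
  (λ i → proj₂ (use (gs↓ i)) Y′ (agree-≤ (ℕ.≤-trans (≤M i) (ℕ.m≤m⊔n M N)) agree))
  (f-use Y′ (agree-≤ (ℕ.m≤n⊔m M N) agree))
use (prec↓0 f↓) with use f↓
... | N , f-use = N , λ Y′ agree → prec↓0 (f-use Y′ agree)
use (prec↓+ r↓ g↓) with use r↓ | use g↓
... | M , r-use | N , g-use = M ℕ.⊔ N , λ Y′ agree → prec↓+
  (r-use Y′ (agree-≤ (ℕ.m≤m⊔n M N) agree)) (g-use Y′ (agree-≤ (ℕ.m≤n⊔m M N) agree))
use {Y} (μ↓ {f = f} {xs} {k} below zero↓k)
  with Fin-bound {k} (λ i → proj₁ (use (proj₂ (below (toℕ i) (Fin.toℕ<n i))))) | use zero↓k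
... | M , ≤M | N , zero-use = M ℕ.⊔ N , λ Y′ agree → μ↓
  (λ i i<k → subst (λ j → ∃[ y ] Y′ ⊢ f [ j ∷ xs ]↓ suc y) (Fin.toℕ-fromℕ< i<k)
    (_ , proj₂ (use (proj₂ (below (toℕ (fromℕ< i<k)) (Fin.toℕ<n (fromℕ< i<k))))) Y′
      (agree-≤ (ℕ.≤-trans (≤M (fromℕ< i<k)) (ℕ.m≤m⊔n M N)) agree)))
  (zero-use Y′ (agree-≤ (ℕ.m≤n⊔m M N) agree))

-- Enumeration of the codes

vecs : ∀ {A : Set} → List A → ∀ m → List (Vec A m)
vecs xs zero    = [] ∷ []
vecs xs (suc m) = cartesianProductWith _∷_ xs (vecs xs m)

∈-vecs : ∀ {A : Set} {xs : List A} {m} (v : Vec A m) → (∀ i → lookup v i ∈ xs) → v ∈ vecs xs m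
∈-vecs []      _  = here refl
∈-vecs (x ∷ v) v∈ = ∈-cartesianProductWith⁺ _∷_ (v∈ zero) (∈-vecs v (v∈ ∘ suc))

initialCodes : ∀ n → List (Code n)
initialCodes 1 = sucᶜ ∷ oracleᶜ ∷ map projᶜ (allFin 1)
initialCodes n = map projᶜ (allFin n)

precCodes : ∀ n → (∀ k → List (Code k)) → List (Code n)
precCodes zero    L = []
precCodes (suc n) L = cartesianProductWith precᶜ (L n) (L (2 ℕ.+ n))

compCodes : ∀ n → ℕ → (∀ k → List (Code k)) → List (Code n)
compCodes n d L = concatMap (λ m → cartesianProductWith compᶜ (L m) (vecs (L n) m)) (upTo d)

-- The parameter limits both the nesting depth and the number of inner functions in a composition,
-- which keeps each list finite.
codes : ℕ → ∀ n → List (Code n)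
codes zero    n = []
codes (suc d) n = zeroᶜ ∷ initialCodes n ++
  compCodes n d (codes d) ++ precCodes n (codes d) ++ map μᶜ (codes d (suc n))

-- Membership is claimed for all large d′ so that the parts of a code can be found in one common
-- list.
codes-complete : ∀ {n} (e : Code n) → ∃[ d ] ∀ d′ → d ℕ.≤ d′ → e ∈ codes d′ n
codes-complete zeroᶜ = 1 , λ { _ (s≤s _) → here refl }
codes-complete sucᶜ = 1 , λ { _ (s≤s _) → there (here refl) }
codes-complete oracleᶜ = 1 , λ { _ (s≤s _) → there (there (here refl)) }
codes-complete {n} (projᶜ i) = 1 , λ { _ (s≤s _) → there (∈-++⁺ˡ (proj∈ n i)) }
  where
  proj∈ : ∀ n i → projᶜ i ∈ initialCodes n
  proj∈ 0             i = ∈-map⁺ projᶜ (∈-allFin i)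
  proj∈ 1             i = there (there (∈-map⁺ projᶜ (∈-allFin i)))
  proj∈ (suc (suc n)) i = ∈-map⁺ projᶜ (∈-allFin i)
codes-complete {n} (compᶜ {m} f gs) with codes-complete f | vec-complete gs
  where
  vec-complete : ∀ {m} (gs : Vec (Code n) m) → ∃[ d ] ∀ d′ → d ℕ.≤ d′ → ∀ i → lookup gs i ∈ codes d′ n
  vec-complete []       = 0 , λ _ _ ()
  vec-complete (g ∷ gs) with codes-complete g | vec-complete gs
  ... | d₁ , g∈ | d₂ , gs∈ = d₁ ℕ.⊔ d₂ , λ d d≥ → λ
    { zero → g∈ d (ℕ.m⊔n≤o⇒m≤o d₁ d₂ d≥) ; (suc i) → gs∈ d (ℕ.m⊔n≤o⇒n≤o d₁ d₂ d≥) i }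
-- The inner `suc m` is there because `upTo d` contains only arities below d.
... | d₁ , f∈ | d₂ , gs∈ = suc (suc m ℕ.⊔ (d₁ ℕ.⊔ d₂)) , λ
  { (suc d) (s≤s d≥) →
    let d₁⊔d₂≤d = ℕ.m⊔n≤o⇒n≤o (suc m) (d₁ ℕ.⊔ d₂) d≥ in
    there (∈-++⁺ʳ (initialCodes n) (∈-++⁺ˡ {xs = compCodes n d (codes d)} (∈-concatMap⁺ _
      (lose (∈-upTo⁺ (ℕ.m⊔n≤o⇒m≤o (suc m) (d₁ ℕ.⊔ d₂) d≥)) (∈-cartesianProductWith⁺ compᶜ
        (f∈ d (ℕ.m⊔n≤o⇒m≤o d₁ d₂ d₁⊔d₂≤d)) (∈-vecs gs (gs∈ d (ℕ.m⊔n≤o⇒n≤o d₁ d₂ d₁⊔d₂≤d)))))))) }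
codes-complete {suc n} (precᶜ f g) with codes-complete f | codes-complete g
... | d₁ , f∈ | d₂ , g∈ = suc (d₁ ℕ.⊔ d₂) , λ { (suc d) (s≤s d≥) →
  there (∈-++⁺ʳ (initialCodes (suc n)) (∈-++⁺ʳ (compCodes (suc n) d (codes d)) (∈-++⁺ˡ (∈-cartesianProductWith⁺ precᶜ
    (f∈ d (ℕ.m⊔n≤o⇒m≤o d₁ d₂ d≥)) (g∈ d (ℕ.m⊔n≤o⇒n≤o d₁ d₂ d≥)))))) }
codes-complete {n} (μᶜ f) with codes-complete f
... | d , f∈ = suc d , λ { (suc d′) (s≤s d≤d′) →
  there (∈-++⁺ʳ (initialCodes n) (∈-++⁺ʳ (compCodes n d′ (codes d′)) (∈-++⁺ʳ (precCodes n (codes d′)) (∈-map⁺ μᶜ (f∈ d′ d≤d′))))) }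

-- Laver trees of finite sets

-- A finite set of numbers is listed in decreasing order.
Node : Set
Node = List ℕ

bound : Node → ℕ
bound []      = 0
bound (n ∷ t) = suc n

set : Node → 2^ω
set []      x = false
set (n ∷ t) x = (x ℕ.≡ᵇ n) ∨ set t x

∈-set-head : ∀ n t → n ∈ω set (n ∷ t)
∈-set-head n t = cong (_∨ set t n) (dec-true (n ℕ.≟ n) refl)

set-∷-below : ∀ {n x} t → x ℕ.< n → set (n ∷ t) x ≡ set t x
set-∷-below {n} {x} t x<n = cong (_∨ set t x) (dec-false (x ℕ.≟ n) (ℕ.<⇒≢ x<n))

set-⊆ : ∀ {X t} → All (_∈ω X) t → set t ⊆ω X
set-⊆ {X} {n ∷ t} (n∈X ∷ t⊆X) x x∈ with x ℕ.≡ᵇ n in x≡ᵇn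
... | true  = subst (_∈ω X) (sym (ℕ.≡ᵇ⇒≡ x n (subst T (sym x≡ᵇn) tt))) n∈X
... | false = set-⊆ t⊆X x x∈

-- End extension: beyond `t`, the set `Y` has only elements that are at least `bound t`.
Extends : Node → 2^ω → Set
Extends t Y = AgreeBelow (bound t) (set t) Y

extends-∷ : ∀ {n Y} t → bound t ℕ.≤ n → Extends (n ∷ t) Y → Extends t Y
extends-∷ t t≤n ext x x<t = trans (sym (set-∷-below t (ℕ.<-≤-trans x<t t≤n)))
  (ext x (ℕ.m<n⇒m<1+n (ℕ.<-≤-trans x<t t≤n)))

module Chain (t : ℕ → Node) (next : ℕ → ℕ)
             (t-suc : ∀ j → t (suc j) ≡ next j ∷ t j) (t≤next : ∀ j → bound (t j) ℕ.≤ next j) where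

  limit : 2^ω
  -- By `j≤bound`, x is below the bound of `t (suc x)`, so later stages do not change this value.
  limit x = set (t (suc x)) x

  j≤bound : ∀ j → j ℕ.≤ bound (t j)
  j≤bound zero    = z≤n
  j≤bound (suc j) = subst (λ s → suc j ℕ.≤ bound s) (sym (t-suc j)) (s≤s (ℕ.≤-trans (j≤bound j) (t≤next j)))

  extends-≤ : ∀ {j k Y} → j ℕ.≤′ k → Extends (t k) Y → Extends (t j) Y
  extends-≤     ℕ.≤′-refl         ext = ext
  extends-≤ {Y = Y} (ℕ.≤′-step {k} j≤k) ext = extends-≤ j≤k
    (extends-∷ (t k) (t≤next k) (subst (λ s → Extends s Y) (t-suc k) ext))

  limit-extends : ∀ j → Extends (t j) limit
  limit-extends j x x<tj with ℕ.≤-total j (suc x)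
  ... | inj₁ j≤ = extends-≤ (ℕ.≤⇒≤′ j≤) (λ _ _ → refl) x x<tj
  ... | inj₂ ≤j = sym (extends-≤ (ℕ.≤⇒≤′ ≤j) (λ _ _ → refl) x (j≤bound (suc x)))

  limit-infinite : Infinite limit
  limit-infinite n = next n , ℕ.≤-trans (j≤bound n) (t≤next n) ,
    trans (sym (subst (λ s → Extends s limit) (t-suc n) (limit-extends (suc n)) (next n) ℕ.≤-refl))
      (∈-set-head (next n) (t n))

Branching : Pred Node 0ℓ → Set
Branching T = ∀ {t} → T t → ∀ N → ∃[ n ] N ℕ.≤ n × T (n ∷ t)

-- Laver trees with stem s; nodes that do not extend s are harmless and allowed.
record Tree (s : Node) : Set₁ where
  field
    node      : Pred Node 0ℓ
    root      : node s
    branching : Branching node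

open Tree

Monotone : Pred Node 0ℓ → Set
Monotone P = ∀ {t n} → bound t ℕ.≤ n → P t → P (n ∷ t)

-- Quantifying over all end extensions makes this monotone in `t`. By `use`, every value computed
-- from a limit of nodes is forced by one of them.
Forces : Code 1 → ℕ → Bool → Pred Node 0ℓ
Forces e i v t = ∀ Y → Extends t Y → Y ⊢ e [ i ∷ [] ]↓ bit v

forces-monotone : ∀ {e i v} → Monotone (Forces e i v)
forces-monotone {t = t} t≤n forces Y ext = forces Y (extends-∷ t t≤n ext)

forces-functional : ∀ {e i v w t} → Forces e i v t → Forces e i w t → v ≡ w
forces-functional {t = t} fv fw =
  bit-injective (↓-functional (fv (set t) (λ _ _ → refl)) (fw (set t) (λ _ _ → refl)))

-- At most one value is left possible; the computation may still diverge.
Decides : Code 1 → ℕ → Pred Node 0ℓ → Set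
Decides e i T = ∃[ b ] ∀ {t v} → T t → Forces e i v t → v ≡ b

decides-⊆ : ∀ {e i} {S T : Pred Node 0ℓ} → S ⊆ T → Decides e i T → Decides e i S
decides-⊆ S⊆T (b , decided) = b , λ t∈S → decided (S⊆T t∈S)

-- Up to finitely many successors at each node, T is barred by P.
data Barred (T P : Pred Node 0ℓ) : Pred Node 0ℓ where
  hit  : ∀ {t} → P t → Barred T P t
  step : ∀ {t} N → (∀ n → N ℕ.≤ n → T (n ∷ t) → Barred T P (n ∷ t)) → Barred T P t

-- A node in `Q` could be extended within `T`, staying in `Q` by monotonicity, until the bar puts it
-- in `P` too.
barred-avoids : ∀ {T P Q t} → Branching T → Monotone Q → (∀ {t} → P t → ¬ Q t) →
                T t → Barred T P t → ¬ Q t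
barred-avoids br mono disj t∈T (hit p) q = disj p q
barred-avoids {t = t} br mono disj t∈T (step N barred) q with br t∈T (N ℕ.⊔ bound t)
... | n , ≤n , n∷t∈T = barred-avoids br mono disj n∷t∈T
  (barred n (ℕ.m⊔n≤o⇒m≤o N (bound t) ≤n) n∷t∈T) (mono (ℕ.m⊔n≤o⇒n≤o N (bound t) ≤n) q)

-- Past the bar, monotonicity makes new larger elements hits again; before it, all but finitely many
-- successors in `T` are barred.
barred-branching : ∀ {T P} → Branching T → Monotone P → Branching (λ t → T t × Barred T P t)
barred-branching br mono {t} (t∈T , hit p) N with br t∈T (N ℕ.⊔ bound t)
... | n , ≤n , n∷t∈T = n , ℕ.m⊔n≤o⇒m≤o N (bound t) ≤n , n∷t∈T , hit (mono (ℕ.m⊔n≤o⇒n≤o N (bound t) ≤n) p)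
barred-branching br mono {t} (t∈T , step M barred) N with br t∈T (N ℕ.⊔ M)
... | n , ≤n , n∷t∈T = n , ℕ.m⊔n≤o⇒m≤o N M ≤n , n∷t∈T , barred n (ℕ.m⊔n≤o⇒n≤o N M ≤n) n∷t∈T

-- Pure decision and thinning

module Construction (em : ExcludedMiddle 0ℓ) where

  open Classical em

  -- If the unbarred successors of a node were bounded, `step` would bar the node itself.
  unbarred-branching : ∀ {T P} → Branching (λ t → T t × ¬ Barred T P t)
  unbarred-branching {T} {P} {t} (t∈T , ¬barred) N = decidable-stable em λ ¬∃ →
    ¬barred (step N λ n N≤n n∷t∈T → decidable-stable em λ ¬b → ¬∃ (n , N≤n , n∷t∈T , ¬b))

  -- If the stem is barred by `P`, the barred nodes form a tree that misses `Q`; otherwise the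
  -- unbarred nodes form one that misses `P`.
  separate : ∀ {s} (T : Tree s) {P Q} → Monotone P → Monotone Q → (∀ {t} → P t → ¬ Q t) →
             Σ[ S ∈ Tree s ] node S ⊆ node T ×
               ((∀ {t} → node S t → ¬ P t) ⊎ (∀ {t} → node S t → ¬ Q t))
  separate {s} T {P} {Q} monoP monoQ disj with em {Barred (node T) P s}
  ... | yes barred = record
      { node      = λ t → node T t × Barred (node T) P t
      ; root      = root T , barred
      ; branching = barred-branching (branching T) monoP
      } , proj₁ , inj₂ λ (t∈T , b) → barred-avoids (branching T) monoQ disj t∈T b
  ... | no ¬barred = record
      { node      = λ t → node T t × ¬ Barred (node T) P t
      ; root      = root T , ¬barred
      ; branching = unbarred-branching
      } , proj₁ , inj₁ λ (_ , ¬b) → ¬b ∘ hit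

  decide : ∀ {s} (T : Tree s) e i → Σ[ S ∈ Tree s ] node S ⊆ node T × Decides e i (node S)
  decide T e i with separate T (forces-monotone {e} {i} {true}) (forces-monotone {e} {i} {false})
    (λ p q → contradiction (forces-functional p q) λ ())
  ... | S , S⊆T , inj₁ ¬true  = S , S⊆T , false , λ
    { {v = false} _ _ → refl ; {v = true} t∈S f → contradiction f (¬true t∈S) }
  ... | S , S⊆T , inj₂ ¬false = S , S⊆T , true , λ
    { {v = true} _ _ → refl ; {v = false} t∈S f → contradiction f (¬false t∈S) }

  decideAll : ∀ {s} (T : Tree s) (tasks : List (Code 1 × ℕ)) →
              Σ[ S ∈ Tree s ] node S ⊆ node T × All (λ (e , i) → Decides e i (node S)) tasks
  decideAll T []              = T , id , []
  decideAll T ((e , i) ∷ tasks) with decide T e i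
  ... | S , S⊆T , decided with decideAll S tasks
  ... | R , R⊆S , all = R , S⊆T ∘ R⊆S , decides-⊆ R⊆S decided ∷ all

  record Condition : Set₁ where
    constructor _,ᶜ_
    field
      {stem} : Node
      tree   : Tree stem

  open Condition

  full : Condition
  full = _,ᶜ_ {[]} record { node = λ _ → ⊤ ; root = tt ; branching = λ _ N → N , ℕ.≤-refl , tt }

  module Thinning (n k : ℕ) (c : Condition) where

    private thinned = decideAll (tree c) (cartesianProduct (codes n 1) (upTo k))

    thin : Tree (stem c)
    thin = proj₁ thinned

    thin-⊆ : node thin ⊆ node (tree c)
    thin-⊆ = proj₁ (proj₂ thinned)

    thin-decides : ∀ {e i} → e ∈ codes n 1 → i ℕ.< k → Decides e i (node thin)
    thin-decides e∈ i<k = All.lookup (proj₂ (proj₂ thinned)) (∈-cartesianProduct⁺ e∈ (∈-upTo⁺ i<k))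

    -- Trees may contain unordered lists; the lower bound keeps stems decreasing.
    IsChild : Pred ℕ 0ℓ
    IsChild i = bound (stem c) ℕ.≤ i × node thin (i ∷ stem c)

    childSet : 2^ω
    childSet i = does (em {IsChild i})

    childSet-infinite : Infinite childSet
    childSet-infinite N with branching thin (root thin) (N ℕ.⊔ bound (stem c))
    ... | i , ≤i , i∈ = i , ℕ.m⊔n≤o⇒m≤o N (bound (stem c)) ≤i ,
      dec-true em (ℕ.m⊔n≤o⇒n≤o N (bound (stem c)) ≤i , i∈)

    width : ℕ
    width = proj₁ (μ-avoid-small k childSet childSet-infinite)

    child : ∀ {i} → IsChild i → Condition
    child {i} (_ , i∈) = _,ᶜ_ {i ∷ stem c} record
      { node = node thin ; root = i∈ ; branching = branching thin }

    childrenAt : ∀ {i} → Dec (IsChild i) → List Condition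
    childrenAt (yes p) = child p ∷ []
    childrenAt (no _)  = []

    children : List Condition
    children = concatMap (λ i → childrenAt (em {IsChild i})) (upTo width)

    child-∈ : ∀ {i} → i ℕ.< width → i ∈ω childSet → Σ[ p ∈ IsChild i ] child p ∈ children
    child-∈ {i} i<width i∈ with at em i∈
      where
      at : (d : Dec (IsChild i)) → does d ≡ true → Σ[ p ∈ IsChild i ] child p ∈ childrenAt d
      at (yes p) _ = p , here refl
    ... | p , ∈at = p , ∈-concatMap⁺ (λ i → childrenAt (em {IsChild i})) (lose (∈-upTo⁺ i<width) ∈at)

    guess : Code 1 → 2^ω
    guess e i = value (em {Decides e i (node thin)})
      where
      value : Dec (Decides e i (node thin)) → Bool
      value (yes (b , _)) = b
      -- A default, not reached when `e` is among `codes n 1` and i < k.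
      value (no _)        = false

    guess-correct : ∀ {e i v t} → Decides e i (node thin) → node thin t → Forces e i v t → v ≡ guess e i
    guess-correct {e} {i} decided t∈ forces with em {Decides e i (node thin)}
    ... | yes (b , correct)  = correct t∈ forces
    ... | no ¬decided        = contradiction decided ¬decided

    -- The sets missing all children of c, and the possible results of Turing
    -- reductions from a set extending c.
    block : List (List Bool)
    block = avoid childSet width ++ map (λ e → applyUpTo (guess e) k) (codes n 1)

    -- One share of `½^ k` is for missing all children, and one for each guessed cylinder of length
    -- k.
    μ-block : μ block ≤ suc (length (codes n 1)) ×ℚ ½^ k
    μ-block = ≤-trans (≤-reflexive (μ-++ (avoid childSet width) _))
      (+-mono-≤ (proj₂ (μ-avoid-small k childSet childSet-infinite))
        (μ-map (λ e → ≤-reflexive (trans (cylinderMeasure≡½^length (applyUpTo (guess e) k))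
          (cong ½^_ (List.length-applyUpTo (guess e) k)))) (codes n 1)))

  -- The stages and the small events `D n`

  open Thinning

  blocks : ℕ → List Condition → ℕ
  blocks n cs = length cs ℕ.* suc (length (codes n 1))

  -- The first summand pays for the number M of shares, as M times 2^-M is at most 1; the second
  -- leaves 2^-(n+1).
  precision : ℕ → List Condition → ℕ
  precision n cs = blocks n cs ℕ.+ suc n

  stage : ℕ → List Condition
  stage zero    = full ∷ []
  stage (suc n) = full ∷ concatMap (children n (precision n (stage n))) (stage n)

  K : ℕ → ℕ
  K n = precision n (stage n)

  D : ℕ → List (List Bool)
  D n = concatMap (block n (K n)) (stage n)

  μD≤ : ∀ n → μ (D n) ≤ ½^ suc n
  μD≤ n = begin
    μ (D n)                                                       ≤⟨ μ-concatMap (μ-block n (K n)) (stage n) ⟩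
    length (stage n) ×ℚ (suc (length (codes n 1)) ×ℚ ½^ K n)      ≡⟨ ×ℚ-*-assoc (length (stage n)) _ _ ⟩
    M ×ℚ ½^ K n                                                   ≡⟨ cong (M ×ℚ_) (½^-+ M (suc n)) ⟩
    M ×ℚ (½^ M * ½^ suc n)                                      ≤⟨ n×½^n*q≤q M (½^-nonneg (suc n)) ⟩
    ½^ suc n                                                      ∎
    where
    open ≤-Reasoning
    M = blocks n (stage n)

  open EventuallyAvoiding D μD≤

  block⇒D : ∀ {n c X} → c ∈ stage n → Covered (block n (K n) c) X → Covered (D n) X
  block⇒D {n} c∈ covered = Any.concatMap⁺ (block n (K n)) (lose c∈ covered)

  full∈stage : ∀ n → full ∈ stage n
  full∈stage zero    = here refl
  full∈stage (suc n) = here refl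

  -- Following a set greedily

  module Greedy (X : 2^ω) (m : ℕ) (avoids : ∀ n → m ℕ.≤ n → ¬ Covered (D n) X) where

    record Position (n : ℕ) : Set₁ where
      field
        condition : Condition
        ∈stage    : condition ∈ stage n
        stem⊆X    : All (_∈ω X) (stem condition)

    open Position

    module _ {n} (m≤n : m ℕ.≤ n) (p : Position n) where

      private c = condition p

      -- If `X` contained none of the listed children, it would be covered by the `avoid` part of
      -- the block, hence by `D n`.
      move : Σ[ i ∈ ℕ ] i ∈ω X × (Σ[ q ∈ IsChild n (K n) c i ] child n (K n) c q ∈ children n (K n) c)
      move with em {∃[ i ] i ℕ.< width n (K n) c × i ∈ω childSet n (K n) c × i ∈ω X}
      ... | yes (i , i<width , i∈ , i∈X) = i , i∈X , child-∈ n (K n) c i<width i∈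
      ... | no ¬∃ = contradiction (block⇒D (∈stage p) (Any.++⁺ˡ (avoid-covers (childSet n (K n) c) (width n (K n) c) X
              λ i i<width i∈ → Bool.¬-not λ i∈X → ¬∃ (i , i<width , i∈ , i∈X))))
            (avoids n m≤n)

      advance : Position (suc n)
      advance = record
        { condition = child n (K n) c (proj₁ (proj₂ (proj₂ move)))
        ; ∈stage    = there (∈-concatMap⁺ (children n (K n)) (lose (∈stage p) (proj₂ (proj₂ (proj₂ move)))))
        ; stem⊆X    = proj₁ (proj₂ move) ∷ stem⊆X p
        }

    play : ∀ j → Position (j ℕ.+ m)
    play zero    = record { condition = full ; ∈stage = full∈stage m ; stem⊆X = [] }
    play (suc j) = advance (ℕ.m≤n+m m j) (play j)

    stemAt : ℕ → Node
    stemAt j = stem (condition (play j))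

    nextAt : ℕ → ℕ
    nextAt j = proj₁ (move (ℕ.m≤n+m m j) (play j))

    open Chain stemAt nextAt (λ _ → refl)
      (λ j → proj₁ (proj₁ (proj₂ (proj₂ (move (ℕ.m≤n+m m j) (play j))))))
      public

    limit-⊆ : limit ⊆ω X
    limit-⊆ x = set-⊆ (stem⊆X (play (suc x))) x

    thinAt : ∀ j → Tree (stemAt j)
    thinAt j = thin (j ℕ.+ m) (K (j ℕ.+ m)) (condition (play j))

    thinAt-antitone : ∀ {j k} → j ℕ.≤′ k → node (thinAt k) ⊆ node (thinAt j)
    thinAt-antitone ℕ.≤′-refl         t∈ = t∈
    thinAt-antitone (ℕ.≤′-step {k} j≤k) t∈ =
      -- The tree of each new condition is the thinned tree of the one before.
      thinAt-antitone j≤k (thin-⊆ (suc k ℕ.+ m) (K (suc k ℕ.+ m)) (condition (play (suc k))) t∈)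

    -- The stem at `j ℕ.+ N` is long enough to contain the use of the computation and still lies in
    -- the tree thinned at step `j`.
    forced : ∀ {e i v} → limit ⊢ e [ i ∷ [] ]↓ bit v → ∀ j → ∃[ t ] node (thinAt j) t × Forces e i v t
    forced ↓v j with use ↓v
    ... | N , Y-use = stemAt (j ℕ.+ N) ,
      thinAt-antitone (ℕ.≤⇒≤′ (ℕ.m≤m+n j N)) (root (thinAt (j ℕ.+ N))) ,
      λ Y ext → Y-use Y λ x x<N →
        let x<bound = ℕ.<-≤-trans x<N (ℕ.≤-trans (ℕ.m≤n+m N j) (j≤bound (j ℕ.+ N)))
        in trans (sym (limit-extends (j ℕ.+ N) x x<bound)) (ext x x<bound)

    -- Each digit of `Z` below `K n` is forced by a node of the thinned tree, so it equals the
    -- guess.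
    reducible-covered : ∀ {Z e} → (∀ i → limit ⊢ e [ i ∷ [] ]↓ bit (Z i)) →
                        ∀ j → e ∈ codes (j ℕ.+ m) 1 → Covered (D (j ℕ.+ m)) Z
    reducible-covered {Z} {e} ↓Z j e∈ =
      block⇒D (∈stage (play j)) (Any.++⁺ʳ (avoid (childSet n k c) (width n k c)) (Any.map⁺ (lose e∈ Z∈)))
      where
      n = j ℕ.+ m
      k = K n
      c = condition (play j)
      g = guess n k c e
      applyUpTo-cong : ∀ (Y Z : 2^ω) k → (∀ i → i ℕ.< k → Y i ≡ Z i) → applyUpTo Y k ≡ applyUpTo Z k
      applyUpTo-cong Y Z zero    eq = refl
      applyUpTo-cong Y Z (suc k) eq = cong₂ _∷_ (eq 0 (s≤s z≤n))
        (applyUpTo-cong (Y ∘ suc) (Z ∘ suc) k (λ i i<k → eq (suc i) (s≤s i<k)))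
      Z≡g : ∀ i → i ℕ.< k → Z i ≡ g i
      Z≡g i i<k with forced (↓Z i) j
      ... | t , t∈ , forces = guess-correct n k c (thin-decides n k c e∈ i<k) t∈ forces
      Z∈ : Cylinder (applyUpTo g k) Z
      Z∈ = trans (cong (applyUpTo Z) (List.length-applyUpTo g k)) (applyUpTo-cong Z g k Z≡g)

    irreducible : ∀ Z → Avoids Z → ¬ (Z ≤T limit)
    irreducible Z (m′ , Z-avoids) (e , ↓Z) with codes-complete e
    ... | d , e∈ = Z-avoids (j ℕ.+ m) (ℕ.≤-trans (ℕ.m≤m+n m′ d) (ℕ.m≤m+n j m))
      (reducible-covered ↓Z j (e∈ (j ℕ.+ m) (ℕ.≤-trans (ℕ.m≤n+m d m′) (ℕ.m≤m+n j m))))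
      -- Far enough for `Z` to avoid `D` and for `e` to be listed.
      where j = m′ ℕ.+ d

corollary4p5 : ExcludedMiddle 0ℓ →
    Σ[ 𝒜 ∈ Event ] AlmostSure 𝒜 ×
    (∀ X → X ∈ᴱ 𝒜 →
    Σ[ Y ∈ 2^ω ] Infinite Y × Y ⊆ω X × (∀ Z → Z ∈ᴱ 𝒜 → ¬ (Z ≤T Y)))
corollary4p5 em = event , event-almostSure , λ X (m , avoids) →
  let open Greedy X m avoids in limit , limit-infinite , limit-⊆ , irreducible
  where
  open Construction em
  open Classical em
  open EventuallyAvoiding D μD≤
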